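{- If $I$ is a finite set of positive integers and $i\in I$, then $d(I;i)=0$, where $d(I;z)$ is the descent polynomial evaluated at $z=i$.
   Context: For a finite set $I$ of positive integers with $m=\max(I\cup\{0\})$ and $n>m$, $d(I;n)$ is the number of permutations $\pi\in\mathfrak S_n$ with $\{j\mid\pi_j>\pi_{j+1}\}=I$; this is a polynomial in $n$, and $d(I;z)$ denotes the polynomial evaluated at an arbitrary complex number $z$. -}

module Defs where

open import Data.Fin.Base using (Fin; toℕ; zero; suc; punchIn) renaming (_>_ to _>ᶠ_)
open import Data.Fin.Permutation as Perm
  using (Permutation′; _⟨$⟩ʳ_; _≈_; insert; remove; insert-punchIn; insert-remove)
open import Data.Fin.Properties using (any?; punchIn-injective; _<?_)
open import Data.Integer.Base using (+_)
open import Data.List.Base using (List; []; _∷_; length; filter; foldr; upTo; allFin; cartesianProductWith)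
open import Data.List.Extrema.Nat using (max)
open import Data.List.Membership.Propositional.Properties using (∈-allFin)
open import Data.List.Relation.Binary.Subset.DecPropositional using (_⊆?_)
open import Data.List.Relation.Binary.Subset.Propositional using (_⊆_)
open import Data.List.Relation.Unary.AllPairs using ([]; _∷_)
open import Data.List.Relation.Unary.All using ([])
open import Data.List.Relation.Unary.Any using (Any; here)
open import Data.List.Relation.Unary.Any.Properties using (cartesianProductWith⁺)
import Data.List.Relation.Unary.Unique.Setoid as UniqueSetoid
import Data.List.Relation.Unary.Unique.Setoid.Properties as Unique
open import Data.List.Relation.Unary.Unique.Propositional.Properties using (allFin⁺)
open import Data.Nat.Base as ℕ using (ℕ; zero; suc)
import Data.Nat.Properties as ℕ
open import Data.Product.Base using (_×_; _,_; ∃₂)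
open import Data.Rational.Base as ℚ using (ℚ; 0ℚ)
open import Level using (0ℓ)
open import Relation.Binary.Bundles using (Setoid)
open import Relation.Binary.PropositionalEquality
  using (_≡_; refl; sym; trans; cong; setoid)
open import Relation.Nullary.Decidable using (Dec; _×-dec_)

-- Position j is 1-based, as in π = π₁ π₂ … πₙ; entries of Fin n are 0-based.
-- So a and b below are the positions j and j + 1.
IsDescent : ∀ {n} → Permutation′ n → ℕ → Set
IsDescent {n} π j =
  ∃₂ λ (a b : Fin n) → suc (toℕ a) ≡ j × toℕ b ≡ j × (π ⟨$⟩ʳ a) >ᶠ (π ⟨$⟩ʳ b)

isDescent? : ∀ {n} (π : Permutation′ n) (j : ℕ) → Dec (IsDescent π j)
isDescent? π j = any? λ a → any? λ b →
  (suc (toℕ a) ℕ.≟ j) ×-dec (toℕ b ℕ.≟ j) ×-dec ((π ⟨$⟩ʳ b) <? (π ⟨$⟩ʳ a))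

-- Every descent is smaller than n, so searching 0, …, n - 1 finds them all.
descents : ∀ {n} → Permutation′ n → List ℕ
descents {n} π = filter (isDescent? π) (upTo n)

-- Finite sets of naturals are represented by lists, compared only through
-- membership; order and repetitions are irrelevant.
HasDescentSet : List ℕ → ∀ {n} → Permutation′ n → Set
HasDescentSet I π = descents π ⊆ I × I ⊆ descents π

hasDescentSet? : ∀ I {n} (π : Permutation′ n) → Dec (HasDescentSet I π)
hasDescentSet? I π = _⊆?_ ℕ._≟_ (descents π) I ×-dec _⊆?_ ℕ._≟_ I (descents π)

-- Choose the first entry, then a permutation of the remaining entries.
permutations : ∀ n → List (Permutation′ n)
permutations zero    = Perm.id ∷ []
permutations (suc n) = cartesianProductWith (insert zero) (allFin (suc n)) (permutations n)

permutationSetoid : ℕ → Setoid 0ℓ 0ℓ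
permutationSetoid n = record
  { Carrier       = Permutation′ n
  ; _≈_           = _≈_
  ; isEquivalence = record
    { refl  = λ _ → refl
    ; sym   = λ e i → sym (e i)
    ; trans = λ e f i → trans (e i) (f i)
    }
  }

-- permutations-complete and permutations-unique: the list contains each
-- element of 𝔖ₙ exactly once up to pointwise equality, so that lengths of its
-- sublists do count permutations.

private
  insert-cong : ∀ {n} (j : Fin (suc n)) {π ρ : Permutation′ n} →
                π ≈ ρ → insert zero j π ≈ insert zero j ρ
  insert-cong j         e zero    = refl
  insert-cong j {π} {ρ} e (suc k) =
    trans (insert-punchIn zero j π k)
      (trans (cong (punchIn j) (e k)) (sym (insert-punchIn zero j ρ k)))

  insert-injective : ∀ {n} {i j : Fin (suc n)} {π ρ : Permutation′ n} →
                     insert zero i π ≈ insert zero j ρ → i ≡ j × π ≈ ρ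
  insert-injective {i = i} {j} {π} {ρ} e with refl ← e zero =
    refl , λ k → punchIn-injective i _ _
      (trans (sym (insert-punchIn zero i π k)) (trans (e (suc k)) (insert-punchIn zero i ρ k)))

permutations-complete : ∀ n (π : Permutation′ n) → Any (π ≈_) (permutations n)
permutations-complete zero    π = here λ ()
permutations-complete (suc n) π =
  cartesianProductWith⁺ (insert zero)
    (λ { {j} {ρ} refl e k →
         trans (sym (insert-remove zero π k)) (insert-cong j {remove zero π} {ρ} e k) })
    (∈-allFin (π ⟨$⟩ʳ zero))
    (permutations-complete n (remove zero π))

permutations-unique : ∀ n → UniqueSetoid.Unique (permutationSetoid n) (permutations n)
permutations-unique zero    = [] ∷ []
permutations-unique (suc n) =
  Unique.cartesianProductWith⁺ (setoid (Fin (suc n))) (permutationSetoid n) (permutationSetoid (suc n))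
    (insert zero) (λ {i} {j} {π} {ρ} → insert-injective {i = i} {j} {π} {ρ})
    (allFin⁺ (suc n)) (permutations-unique n)

-- d(I; n) as a count.
d : List ℕ → ℕ → ℕ
d I n = length (filter (hasDescentSet? I) (permutations n))

-- Coefficients in order of increasing degree. Rational coefficients lose no
-- generality: a complex polynomial taking rational values at infinitely many
-- integers has rational coefficients.
Polynomial : Set
Polynomial = List ℚ

evaluate : Polynomial → ℚ → ℚ
evaluate p z = foldr (λ c r → c ℚ.+ z ℚ.* r) 0ℚ p

fromℕ : ℕ → ℚ
fromℕ n = + n ℚ./ 1

-- p is d(I; z). The condition fixes p's values at infinitely many points,
-- hence determines p up to trailing zero coefficients.
IsDescentPolynomial : List ℕ → Polynomial → Set
IsDescentPolynomial I p =
  ∀ n → max 0 I ℕ.< n → evaluate p (fromℕ n) ≡ fromℕ (d I n)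

{-# OPTIONS --safe #-}
-- Let m be the largest element of I and J = I ∖ {m}. Then
--   d(I; z) + d(J; z) = d(J; m) · binomial(z, m),
-- because choosing the values of the first m entries freely and arranging each
-- block gives a permutation whose descent set is I or J. At z = m the right side
-- is d(J; m), and at z = i < m it is 0, while d(J; i) = 0 by induction.
--
-- The identity is proved on the numbers of permutations with given descents and
-- given first entry, which are iterated partial sums. Seen as coefficients in the
-- (scaled) Bernstein basis, partial sums are integrals and commute with raising
-- the degree; this replaces the enumeration of the blocks by linear algebra.
module Submission where

open import Defs
open import Data.Bool.Base using (Bool; true; false; _∧_; not; if_then_else_)
import Data.Bool.Properties as Bool
open import Data.Fin.Base using (Fin; zero; suc; toℕ; fromℕ<; inject₁; punchIn)
open import Data.Fin.Permutation using (Permutation′; _⟨$⟩ʳ_; insert; insert-punchIn)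
open import Data.Fin.Properties using (all?; toℕ<n; toℕ-fromℕ<; toℕ-inject₁; toℕ-injective; _<?_)
import Data.Integer.Base as ℤ
import Data.Integer.Properties as ℤ
open import Data.List.Base using (List; []; _∷_; _++_; cartesianProductWith; filter; length; map; tabulate; upTo)
open import Data.List.Extrema.Nat using (max; xs≤max)
open import Data.List.Membership.DecPropositional using (_∈?_)
open import Data.List.Membership.Propositional using (_∈_)
open import Data.List.Membership.Propositional.Properties using (∈-filter⁺; ∈-filter⁻; ∈-upTo⁺)
open import Data.List.Properties using (filter-++; filter-≐; filter-none; length-++)
open import Data.List.Relation.Unary.All as All using (All)
open import Data.Nat.Base as ℕ using (ℕ; zero; suc; z≤n; s≤s; _≤_; _<_; _<ᵇ_)
import Data.Nat.Properties as ℕ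
open import Data.Product.Base using (∃; _×_; _,_; proj₁; proj₂)
open import Data.Rational.Base using (ℚ; 0ℚ; 1ℚ; _+_; _*_; _-_; -_; NonZero; 1/_; fromℚᵘ; toℚᵘ)
open import Data.Rational.Properties
  using ( _≟_; +-assoc; +-comm; +-identityˡ; +-identityʳ; +-inverseʳ; +-*-commutativeRing
        ; *-assoc; *-distribˡ-+; *-identityˡ; *-identityʳ; *-inverseˡ; *-zeroˡ; *-zeroʳ
        ; normalize-pos; pos⇒nonZero; toℚᵘ-fromℚᵘ; toℚᵘ-homo-+; toℚᵘ-injective)
open import Data.Rational.Unnormalised.Base as ℚᵘ using (mkℚᵘ; *≡*)
import Data.Rational.Unnormalised.Properties as ℚᵘ
open import Data.Sum.Base using (inj₁; inj₂; [_,_]′)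
open import Function.Base using (_∘_; id)
open import Function.Bundles using (_⇔_; mk⇔; Equivalence)
open import Level using (0ℓ)
open import Relation.Binary.Definitions using (tri<; tri≈; tri>)
open import Relation.Binary.PropositionalEquality
  using (_≡_; _≢_; _≗_; refl; sym; trans; cong; cong₂; subst; subst₂; module ≡-Reasoning)
open import Relation.Nullary.Decidable using (Dec; does; yes; no; dec-true; dec-false; dec⇒maybe; does-⇔)
open import Relation.Nullary.Negation.Core using (contradiction)
open import Relation.Unary using (Pred; Decidable)
open import Tactic.RingSolver using (solve-∀)
open import Tactic.RingSolver.Core.AlmostCommutativeRing using (AlmostCommutativeRing; fromCommutativeRing)

-- Naturals inside the rationals

ℚ-ring : AlmostCommutativeRing 0ℓ 0ℓ
ℚ-ring = fromCommutativeRing +-*-commutativeRing (λ x → dec⇒maybe (0ℚ ≟ x))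

fromℕ-suc : ∀ n → fromℕ (suc n) ≡ 1ℚ + fromℕ n
fromℕ-suc n = toℚᵘ-injective (begin
  toℚᵘ (fromℚᵘ (mkℚᵘ (ℤ.+ suc n) 0)) ≈⟨ toℚᵘ-fromℚᵘ _ ⟩
  mkℚᵘ (ℤ.+ suc n) 0                 ≈⟨ *≡* (cong (λ z → (ℤ.1ℤ ℤ.+ z) ℤ.* ℤ.1ℤ) (sym (ℤ.*-identityʳ (ℤ.+ n)))) ⟩
  toℚᵘ 1ℚ ℚᵘ.+ mkℚᵘ (ℤ.+ n) 0        ≈⟨ ℚᵘ.+-congʳ (toℚᵘ 1ℚ) (toℚᵘ-fromℚᵘ (mkℚᵘ (ℤ.+ n) 0)) ⟨
  toℚᵘ 1ℚ ℚᵘ.+ toℚᵘ (fromℕ n)        ≈⟨ toℚᵘ-homo-+ 1ℚ (fromℕ n) ⟨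
  toℚᵘ (1ℚ + fromℕ n)                ∎)
  where open ℚᵘ.≃-Reasoning

fromℕ-+ : ∀ m n → fromℕ (m ℕ.+ n) ≡ fromℕ m + fromℕ n
fromℕ-+ zero    n = sym (+-identityˡ (fromℕ n))
fromℕ-+ (suc m) n = begin
  fromℕ (suc (m ℕ.+ n))     ≡⟨ fromℕ-suc (m ℕ.+ n) ⟩
  1ℚ + fromℕ (m ℕ.+ n)      ≡⟨ cong (1ℚ +_) (fromℕ-+ m n) ⟩
  1ℚ + (fromℕ m + fromℕ n)  ≡⟨ +-assoc 1ℚ (fromℕ m) (fromℕ n) ⟨
  (1ℚ + fromℕ m) + fromℕ n  ≡⟨ cong (_+ fromℕ n) (fromℕ-suc m) ⟨
  fromℕ (suc m) + fromℕ n   ∎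
  where open ≡-Reasoning

fromℕ-∸ : ∀ {m n} → m ℕ.≤ n → fromℕ (n ℕ.∸ m) ≡ fromℕ n - fromℕ m
fromℕ-∸ {m} {n} m≤n = begin
  fromℕ (n ℕ.∸ m)                        ≡⟨ x≡x+y-y (fromℕ (n ℕ.∸ m)) (fromℕ m) ⟩
  (fromℕ (n ℕ.∸ m) + fromℕ m) - fromℕ m  ≡⟨ cong (_- fromℕ m) (fromℕ-+ (n ℕ.∸ m) m) ⟨
  fromℕ (n ℕ.∸ m ℕ.+ m) - fromℕ m        ≡⟨ cong (λ k → fromℕ k - fromℕ m) (ℕ.m∸n+n≡m m≤n) ⟩
  fromℕ n - fromℕ m                      ∎
  where
  open ≡-Reasoning
  x≡x+y-y : ∀ x y → x ≡ (x + y) - y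
  x≡x+y-y = solve-∀ ℚ-ring

fromℕ-nonZero : ∀ n → NonZero (fromℕ (suc n))
fromℕ-nonZero n = pos⇒nonZero (fromℕ (suc n)) {{normalize-pos (suc n) 1}}

*-cancelˡ : ∀ x .{{_ : NonZero x}} {y z} → x * y ≡ x * z → y ≡ z
*-cancelˡ x {y} {z} xy≡xz = begin
  y               ≡⟨ undo y ⟨
  1/ x * (x * y)  ≡⟨ cong (1/ x *_) xy≡xz ⟩
  1/ x * (x * z)  ≡⟨ undo z ⟩
  z               ∎
  where
  open ≡-Reasoning
  undo : ∀ w → 1/ x * (x * w) ≡ w
  undo w = begin
    1/ x * (x * w)  ≡⟨ *-assoc (1/ x) x w ⟨
    1/ x * x * w    ≡⟨ cong (_* w) (*-inverseˡ x) ⟩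
    1ℚ * w          ≡⟨ *-identityˡ w ⟩
    w               ∎

-- Counting by descents and first entry

Σ< : ℕ → (ℕ → ℚ) → ℚ
Σ< zero    c = 0ℚ
Σ< (suc j) c = Σ< j c + c j

Σ<-cong : ∀ j {c c′} → (∀ {k} → k ℕ.< j → c k ≡ c′ k) → Σ< j c ≡ Σ< j c′
Σ<-cong zero    e = refl
Σ<-cong (suc j) e = cong₂ _+_ (Σ<-cong j (e ∘ ℕ.m<n⇒m<1+n)) (e ℕ.≤-refl)

Σ<-+ : ∀ j c c′ → Σ< j (λ k → c k + c′ k) ≡ Σ< j c + Σ< j c′
Σ<-+ zero    c c′ = refl
Σ<-+ (suc j) c c′ = trans (cong (_+ (c j + c′ j)) (Σ<-+ j c c′)) (lemma (Σ< j c) (Σ< j c′) (c j) (c′ j))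
  where
  lemma : ∀ x y z w → (x + y) + (z + w) ≡ (x + z) + (y + w)
  lemma = solve-∀ ℚ-ring

Σ<-* : ∀ j x c → Σ< j (λ k → x * c k) ≡ x * Σ< j c
Σ<-* zero    x c = sym (*-zeroʳ x)
Σ<-* (suc j) x c = trans (cong (_+ x * c j) (Σ<-* j x c)) (sym (*-distribˡ-+ x (Σ< j c) (c j)))

-- The effect of prepending the entry j to permutations counted by first entry k:
-- a descent requires k < j, an ascent j ≤ k ≤ n.
step : Bool → ℕ → (ℕ → ℚ) → ℕ → ℚ
step true  n c j = Σ< j c
step false n c j = Σ< (suc n) c - Σ< j c

step-cong : ∀ b n {c c′} → c ≗ c′ → ∀ j → step b n c j ≡ step b n c′ j
step-cong true  n e j = Σ<-cong j λ {k} _ → e k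
step-cong false n e j = cong₂ _-_ (Σ<-cong (suc n) λ {k} _ → e k) (Σ<-cong j λ {k} _ → e k)

step-+ : ∀ b n c c′ j → step b n (λ k → c k + c′ k) j ≡ step b n c j + step b n c′ j
step-+ true  n c c′ j = Σ<-+ j c c′
step-+ false n c c′ j = trans (cong₂ _-_ (Σ<-+ (suc n) c c′) (Σ<-+ j c c′))
  (lemma (Σ< (suc n) c) (Σ< (suc n) c′) (Σ< j c) (Σ< j c′))
  where
  lemma : ∀ x y z w → (x + y) - (z + w) ≡ (x - z) + (y - w)
  lemma = solve-∀ ℚ-ring

step-* : ∀ b n x c j → step b n (λ k → x * c k) j ≡ x * step b n c j
step-* true  n x c j = Σ<-* j x c
step-* false n x c j = trans (cong₂ _-_ (Σ<-* (suc n) x c) (Σ<-* j x c)) (lemma x (Σ< (suc n) c) (Σ< j c))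
  where
  lemma : ∀ x y z → x * y - x * z ≡ x * (y - z)
  lemma = solve-∀ ℚ-ring

-- Degree elevation n ↦ n + 1 of coefficients in the scaled Bernstein basis
-- xᵏ (1 - x)ⁿ⁻ᵏ / (k! (n - k)!).
elevate : ℕ → (ℕ → ℚ) → ℕ → ℚ
elevate n c zero    = fromℕ (suc n) * c zero
elevate n c (suc k) = fromℕ (suc k) * c k + (fromℕ n - fromℕ k) * c (suc k)

-- Partial sums are the coefficients, one degree higher, of the integral from 0, while `elevate`
-- rewrites the same polynomial; hence the two commute.
elevate-Σ< : ∀ n c j → elevate (suc n) (λ k → Σ< k c) j ≡ Σ< j (elevate n c)
elevate-Σ< n c zero = *-zeroʳ (fromℕ (suc (suc n)))
elevate-Σ< n c (suc zero) = lemma (fromℕ (suc n)) (c 0)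
  where
  lemma : ∀ ν x → 1ℚ * 0ℚ + (ν - 0ℚ) * (0ℚ + x) ≡ 0ℚ + ν * x
  lemma = solve-∀ ℚ-ring
elevate-Σ< n c (suc (suc k)) = begin
  fromℕ (2 ℕ.+ k) * (s + x) + (fromℕ (suc n) - fromℕ (suc k)) * (s + x + y)
    ≡⟨ cong₂ (λ u v → u * (s + x) + (v - fromℕ (suc k)) * (s + x + y)) (fromℕ-suc (suc k)) (fromℕ-suc n) ⟩
  (1ℚ + fromℕ (suc k)) * (s + x) + (1ℚ + fromℕ n - fromℕ (suc k)) * (s + x + y)
    ≡⟨ cong (λ u → (1ℚ + u) * (s + x) + (1ℚ + fromℕ n - u) * (s + x + y)) (fromℕ-suc k) ⟩
  (1ℚ + (1ℚ + fromℕ k)) * (s + x) + (1ℚ + fromℕ n - (1ℚ + fromℕ k)) * (s + x + y)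
    ≡⟨ lemma (fromℕ n) (fromℕ k) s x y ⟩
  ((1ℚ + fromℕ k) * s + (1ℚ + fromℕ n - fromℕ k) * (s + x)) + ((1ℚ + fromℕ k) * x + (fromℕ n - fromℕ k) * y)
    ≡⟨ cong₂ (λ u v → (u * s + (v - fromℕ k) * (s + x)) + (u * x + (fromℕ n - fromℕ k) * y)) (fromℕ-suc k) (fromℕ-suc n) ⟨
  elevate (suc n) (λ i → Σ< i c) (suc k) + elevate n c (suc k)
    ≡⟨ cong (_+ elevate n c (suc k)) (elevate-Σ< n c (suc k)) ⟩
  Σ< (suc k) (elevate n c) + elevate n c (suc k) ∎
  where
  open ≡-Reasoning
  s = Σ< k c
  x = c k
  y = c (suc k)
  lemma : ∀ ν κ s x y → (1ℚ + (1ℚ + κ)) * (s + x) + (1ℚ + ν - (1ℚ + κ)) * (s + x + y) ≡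
          ((1ℚ + κ) * s + (1ℚ + ν - κ) * (s + x)) + ((1ℚ + κ) * x + (ν - κ) * y)
  lemma = solve-∀ ℚ-ring

-- Constant coefficients `x` in degree n represent the constant polynomial x / n!.
elevate-const : ∀ n x j → elevate n (λ _ → x) j ≡ fromℕ (suc n) * x
elevate-const n x zero    = refl
elevate-const n x (suc k) =
  trans (cong (λ u → u * x + (fromℕ n - fromℕ k) * x) (fromℕ-suc k))
    (trans (lemma (fromℕ n) (fromℕ k) x) (cong (_* x) (sym (fromℕ-suc n))))
  where
  lemma : ∀ ν κ x → (1ℚ + κ) * x + (ν - κ) * x ≡ (1ℚ + ν) * x
  lemma = solve-∀ ℚ-ring

elevate-minus : ∀ n c c′ j → elevate n (λ k → c k - c′ k) j ≡ elevate n c j - elevate n c′ j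
elevate-minus n c c′ zero    = lemma (fromℕ (suc n)) (c 0) (c′ 0)
  where
  lemma : ∀ ν x y → ν * (x - y) ≡ ν * x - ν * y
  lemma = solve-∀ ℚ-ring
elevate-minus n c c′ (suc k) = lemma (fromℕ (suc k)) (fromℕ n - fromℕ k) (c k) (c′ k) (c (suc k)) (c′ (suc k))
  where
  lemma : ∀ u v x y z w → u * (x - y) + v * (z - w) ≡ u * x + v * z - (u * y + v * w)
  lemma = solve-∀ ℚ-ring

-- The sum of the coefficients in degree n is (n + 1)! times the integral over [0, 1], which
-- elevation preserves. The proof takes `elevate-Σ<` at the top index, where the second weight
-- vanishes.
Σ<-elevate : ∀ n c → Σ< (2 ℕ.+ n) (elevate n c) ≡ fromℕ (2 ℕ.+ n) * Σ< (suc n) c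
Σ<-elevate n c = trans (sym (elevate-Σ< n c (2 ℕ.+ n))) (lemma (fromℕ (2 ℕ.+ n)) (fromℕ (suc n)) _ _)
  where
  lemma : ∀ u v x y → u * x + (v - v) * y ≡ u * x
  lemma = solve-∀ ℚ-ring

-- A descent step integrates from 0 to x. An ascent step integrates from x to 1, that is, subtracts
-- the integral from 0 from the full integral, a constant.
elevate-step : ∀ b n c j → elevate (suc n) (step b n c) j ≡ step b (suc n) (elevate n c) j
elevate-step true  n c j = elevate-Σ< n c j
elevate-step false n c j = begin
  elevate (suc n) (step false n c) j
    ≡⟨ elevate-minus (suc n) (λ _ → Σ< (suc n) c) (λ k → Σ< k c) j ⟩
  elevate (suc n) (λ _ → Σ< (suc n) c) j - elevate (suc n) (λ k → Σ< k c) j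
    ≡⟨ cong₂ _-_ (trans (elevate-const (suc n) (Σ< (suc n) c) j) (sym (Σ<-elevate n c))) (elevate-Σ< n c j) ⟩
  Σ< (2 ℕ.+ n) (elevate n c) - Σ< j (elevate n c) ∎
  where open ≡-Reasoning

-- The number of permutations of n + 1 entries starting with the j-th smallest one
-- (l, j ≤ n, j counted from 0; other values are junk) that for t < l have a descent at
-- position t + 1 exactly when χ t, no condition at position l + 1, and ascents at
-- all later positions.
prefixCount : (ℕ → Bool) → ℕ → ℕ → ℕ → ℚ
prefixCount χ zero    n       j = 1ℚ
prefixCount χ (suc l) zero    j = 0ℚ
prefixCount χ (suc l) (suc n) j = step (χ 0) n (prefixCount (χ ∘ suc) l n) j

-- The recursion starts from a constant, on which elevation multiplies by the degree plus one, and
-- every `step` commutes with elevation. The factor stays the same because `n` and `l` drop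
-- together.
elevate-prefixCount : ∀ χ {l n} → l ℕ.≤ n → ∀ j →
  elevate n (prefixCount χ l n) j ≡ fromℕ (suc n ℕ.∸ l) * prefixCount χ l (suc n) j
elevate-prefixCount χ {n = n} z≤n j = elevate-const n 1ℚ j
elevate-prefixCount χ {suc l} {suc n} (s≤s l≤n) j = begin
  elevate (suc n) (step (χ 0) n (prefixCount (χ ∘ suc) l n)) j
    ≡⟨ elevate-step (χ 0) n (prefixCount (χ ∘ suc) l n) j ⟩
  step (χ 0) (suc n) (elevate n (prefixCount (χ ∘ suc) l n)) j
    ≡⟨ step-cong (χ 0) (suc n) (elevate-prefixCount (χ ∘ suc) l≤n) j ⟩
  step (χ 0) (suc n) (λ k → fromℕ (suc n ℕ.∸ l) * prefixCount (χ ∘ suc) l (suc n) k) j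
    ≡⟨ step-* (χ 0) (suc n) (fromℕ (suc n ℕ.∸ l)) (prefixCount (χ ∘ suc) l (suc n)) j ⟩
  fromℕ (suc n ℕ.∸ l) * step (χ 0) (suc n) (prefixCount (χ ∘ suc) l (suc n)) j ∎
  where open ≡-Reasoning

-- With `l` = `n` the free position lies beyond the end of the permutation, so `χ` prescribes every
-- position.
count : (ℕ → Bool) → ℕ → ℕ → ℚ
count χ n = prefixCount χ n n

total : (ℕ → Bool) → ℕ → ℚ
total χ n = Σ< (suc n) (count χ n)

prefixCount-cong : ∀ {χ χ′} l n → (∀ {t} → t ℕ.< l → χ t ≡ χ′ t) →
                   ∀ j → prefixCount χ l n j ≡ prefixCount χ′ l n j
prefixCount-cong zero    n       e j = refl
prefixCount-cong (suc l) zero    e j = refl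
prefixCount-cong {χ} {χ′} (suc l) (suc n) e j =
  trans (cong (λ b → step b n (prefixCount (χ ∘ suc) l n) j) (e (s≤s z≤n)))
        (step-cong (χ′ 0) n (prefixCount-cong l n (e ∘ s≤s)) j)

-- Only the increasing permutation is counted and it starts with entry 0, so every nonempty partial
-- sum is already 1. Partial sums suit the induction because an ascent step is a difference of two
-- of them.
Σ<-ascending : ∀ {χ} → (∀ t → χ t ≡ false) → ∀ n {j} → j ℕ.≤ n → Σ< (suc j) (count χ n) ≡ 1ℚ
Σ<-ascending e zero    {zero} z≤n = refl
Σ<-ascending {χ} e (suc n) {zero} z≤n rewrite e 0 =
  trans (lemma (Σ< (suc n) (count (χ ∘ suc) n))) (Σ<-ascending (e ∘ suc) n ℕ.≤-refl)
  where
  lemma : ∀ x → 0ℚ + (x - 0ℚ) ≡ x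
  lemma = solve-∀ ℚ-ring
Σ<-ascending {χ} e (suc n) {suc j} (s≤s j≤n) =
  trans (cong₂ _+_ (Σ<-ascending e (suc n) (ℕ.m≤n⇒m≤1+n j≤n)) vanish) (+-identityʳ 1ℚ)
  where
  vanish : count χ (suc n) (suc j) ≡ 0ℚ
  vanish rewrite e 0 = cong₂ _-_ (Σ<-ascending (e ∘ suc) n ℕ.≤-refl) (Σ<-ascending (e ∘ suc) n j≤n)

ascending : ∀ {χ} → (∀ t → χ t ≡ false) → ∀ n → total χ n ≡ 1ℚ
ascending e n = Σ<-ascending e n ℕ.≤-refl

-- A permutation either descends or ascends at position `l` + 1, and the patterns agree elsewhere,
-- so together they leave that position free. Linearity of `step` carries the case `l` = 0 through
-- the common prefix.
merge : ∀ {χ χ′ l n} → l ℕ.≤ n → χ l ≡ true → χ′ l ≡ false →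
        (∀ {t} → t ℕ.< l → χ t ≡ χ′ t) →
        (∀ {t} → l ℕ.< t → χ t ≡ false) → (∀ {t} → l ℕ.< t → χ′ t ≡ false) →
        ∀ j → count χ (suc n) j + count χ′ (suc n) j ≡ prefixCount χ l (suc n) j
merge {χ} {χ′} {n = n} z≤n on off e past past′ j rewrite on | off = begin
  Σ< j c + (Σ< (suc n) c′ - Σ< j c′)
    ≡⟨ cong₂ (λ x y → x + (y - Σ< j c′)) (Σ<-cong j λ {k} _ → c≗c′ k) (ascending (λ _ → past′ (s≤s z≤n)) n) ⟩
  Σ< j c′ + (1ℚ - Σ< j c′)
    ≡⟨ lemma (Σ< j c′) ⟩
  1ℚ ∎
  where
  open ≡-Reasoning
  c  = count (χ ∘ suc) n
  c′ = count (χ′ ∘ suc) n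
  c≗c′ : c ≗ c′
  c≗c′ = prefixCount-cong n n λ _ → trans (past (s≤s z≤n)) (sym (past′ (s≤s z≤n)))
  lemma : ∀ x → x + (1ℚ - x) ≡ 1ℚ
  lemma = solve-∀ ℚ-ring
merge {χ} {χ′} {suc l} {suc n} (s≤s l≤n) on off e past past′ j = begin
  step (χ 0) (suc n) c j + step (χ′ 0) (suc n) c′ j
    ≡⟨ cong (λ b → step (χ 0) (suc n) c j + step b (suc n) c′ j) (e (s≤s z≤n)) ⟨
  step (χ 0) (suc n) c j + step (χ 0) (suc n) c′ j
    ≡⟨ step-+ (χ 0) (suc n) c c′ j ⟨
  step (χ 0) (suc n) (λ k → c k + c′ k) j
    ≡⟨ step-cong (χ 0) (suc n) (merge l≤n on off (e ∘ s≤s) (past ∘ s≤s) (past′ ∘ s≤s)) j ⟩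
  step (χ 0) (suc n) (prefixCount (χ ∘ suc) l (suc n)) j ∎
  where
  open ≡-Reasoning
  c  = count (χ ∘ suc) (suc n)
  c′ = count (χ′ ∘ suc) (suc n)

-- This recursion in n is also that of binomial(n + 1, l + 1), given by `binomial-suc`.
total-prefixCount : ∀ χ {l n} → l ℕ.≤ n →
  fromℕ (suc n ℕ.∸ l) * Σ< (2 ℕ.+ n) (prefixCount χ l (suc n)) ≡
  fromℕ (2 ℕ.+ n) * Σ< (suc n) (prefixCount χ l n)
total-prefixCount χ {l} {n} l≤n = begin
  fromℕ (suc n ℕ.∸ l) * Σ< (2 ℕ.+ n) (prefixCount χ l (suc n))
    ≡⟨ Σ<-* (2 ℕ.+ n) (fromℕ (suc n ℕ.∸ l)) (prefixCount χ l (suc n)) ⟨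
  Σ< (2 ℕ.+ n) (λ k → fromℕ (suc n ℕ.∸ l) * prefixCount χ l (suc n) k)
    ≡⟨ Σ<-cong (2 ℕ.+ n) (λ {k} _ → elevate-prefixCount χ l≤n k) ⟨
  Σ< (2 ℕ.+ n) (elevate n (prefixCount χ l n))
    ≡⟨ Σ<-elevate n (prefixCount χ l n) ⟩
  fromℕ (2 ℕ.+ n) * Σ< (suc n) (prefixCount χ l n) ∎
  where open ≡-Reasoning

-- Binomial coefficients with rational upper argument

1/suc_ : ℕ → ℚ
1/suc l = 1/_ (fromℕ (suc l)) {{fromℕ-nonZero l}}

binomial : ℕ → ℚ → ℚ
binomial zero    z = 1ℚ
binomial (suc l) z = 1/suc l * ((z - fromℕ l) * binomial l z)

-- Both sides are (z + 1) z (z - 1) ⋯ (z - l + 1) / l!.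
binomial-suc : ∀ l z → (1ℚ + z - fromℕ l) * binomial l (1ℚ + z) ≡ (1ℚ + z) * binomial l z
binomial-suc zero    z = cong (_* 1ℚ) (+-identityʳ (1ℚ + z))
binomial-suc (suc l) z = begin
  (1ℚ + z - fromℕ (suc l)) * (a * ((1ℚ + z - fromℕ l) * binomial l (1ℚ + z)))
    ≡⟨ cong₂ (λ u v → (1ℚ + z - u) * (a * v)) (fromℕ-suc l) (binomial-suc l z) ⟩
  (1ℚ + z - (1ℚ + fromℕ l)) * (a * ((1ℚ + z) * binomial l z))
    ≡⟨ lemma z (fromℕ l) a (binomial l z) ⟩
  (1ℚ + z) * (a * ((z - fromℕ l) * binomial l z)) ∎
  where
  open ≡-Reasoning
  a = 1/suc l
  lemma : ∀ z l a b → (1ℚ + z - (1ℚ + l)) * (a * ((1ℚ + z) * b)) ≡ (1ℚ + z) * (a * ((z - l) * b))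
  lemma = solve-∀ ℚ-ring

binomial-diagonal : ∀ l → binomial l (fromℕ l) ≡ 1ℚ
binomial-diagonal zero    = refl
binomial-diagonal (suc l) = begin
  1/suc l * ((fromℕ (suc l) - fromℕ l) * binomial l (fromℕ (suc l)))
    ≡⟨ cong (λ u → 1/suc l * ((u - fromℕ l) * binomial l u)) (fromℕ-suc l) ⟩
  1/suc l * ((1ℚ + fromℕ l - fromℕ l) * binomial l (1ℚ + fromℕ l))
    ≡⟨ cong (1/suc l *_) (binomial-suc l (fromℕ l)) ⟩
  1/suc l * ((1ℚ + fromℕ l) * binomial l (fromℕ l))
    ≡⟨ cong₂ (λ u v → 1/suc l * (u * v)) (sym (fromℕ-suc l)) (binomial-diagonal l) ⟩
  1/suc l * (fromℕ (suc l) * 1ℚ)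
    ≡⟨ cong (1/suc l *_) (*-identityʳ (fromℕ (suc l))) ⟩
  1/suc l * fromℕ (suc l)
    ≡⟨ *-inverseˡ (fromℕ (suc l)) {{fromℕ-nonZero l}} ⟩
  1ℚ ∎
  where open ≡-Reasoning

binomial-zero : ∀ {i l} → i ℕ.< l → binomial l (fromℕ i) ≡ 0ℚ
binomial-zero {i} {suc l} (s≤s i≤l) = trans (cong (1/suc l *_) (factor i≤l)) (*-zeroʳ (1/suc l))
  where
  factor : i ℕ.≤ l → (fromℕ i - fromℕ l) * binomial l (fromℕ i) ≡ 0ℚ
  factor i≤l with ℕ.m≤n⇒m<n∨m≡n i≤l
  ... | inj₁ i<l  = trans (cong ((fromℕ i - fromℕ l) *_) (binomial-zero i<l)) (*-zeroʳ (fromℕ i - fromℕ l))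
  ... | inj₂ refl = trans (cong (_* binomial i (fromℕ i)) (+-inverseʳ (fromℕ i))) (*-zeroˡ (binomial i (fromℕ i)))

-- Choose the values in the first `l` + 1 positions, arrange them by `χ` and sort the rest.
-- Formally, both sides satisfy the same recursion in n = k + l and agree at n = l, where the
-- binomial coefficient is 1.
total-prefixCount-binomial : ∀ χ l k →
  Σ< (suc (k ℕ.+ l)) (prefixCount χ l (k ℕ.+ l)) ≡
  total χ l * binomial (suc l) (fromℕ (suc (k ℕ.+ l)))
total-prefixCount-binomial χ l zero    = sym (trans (cong (total χ l *_) (binomial-diagonal (suc l))) (*-identityʳ (total χ l)))
-- The weight n + 1 - l in the recursion is k + 1, hence can be cancelled.
total-prefixCount-binomial χ l (suc k) = *-cancelˡ (fromℕ (suc k)) {{fromℕ-nonZero k}} (begin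
  fromℕ (suc k) * Σ< (2 ℕ.+ n) (prefixCount χ l (suc n))
    ≡⟨ cong (λ i → fromℕ i * Σ< (2 ℕ.+ n) (prefixCount χ l (suc n))) (ℕ.m+n∸n≡m (suc k) l) ⟨
  fromℕ (suc n ℕ.∸ l) * Σ< (2 ℕ.+ n) (prefixCount χ l (suc n))
    ≡⟨ total-prefixCount χ (ℕ.m≤n+m l k) ⟩
  fromℕ (2 ℕ.+ n) * Σ< (suc n) (prefixCount χ l n)
    ≡⟨ cong₂ _*_ (fromℕ-suc (suc n)) (total-prefixCount-binomial χ l k) ⟩
  (1ℚ + z) * (total χ l * binomial (suc l) z)
    ≡⟨ swap (1ℚ + z) (total χ l) (binomial (suc l) z) ⟩
  total χ l * ((1ℚ + z) * binomial (suc l) z)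
    ≡⟨ cong (total χ l *_) (binomial-suc (suc l) z) ⟨
  total χ l * ((1ℚ + z - fromℕ (suc l)) * binomial (suc l) (1ℚ + z))
    ≡⟨ cong (λ u → total χ l * ((u - fromℕ (suc l)) * binomial (suc l) u)) (fromℕ-suc (suc n)) ⟨
  total χ l * ((fromℕ (2 ℕ.+ n) - fromℕ (suc l)) * binomial (suc l) (fromℕ (2 ℕ.+ n)))
    ≡⟨ cong (λ u → total χ l * (u * binomial (suc l) (fromℕ (2 ℕ.+ n))))
            (trans (sym (fromℕ-∸ (s≤s (ℕ.m≤n+m l (suc k))))) (cong fromℕ (ℕ.m+n∸n≡m (suc k) l))) ⟩
  total χ l * (fromℕ (suc k) * binomial (suc l) (fromℕ (2 ℕ.+ n)))
    ≡⟨ swap (fromℕ (suc k)) (total χ l) (binomial (suc l) (fromℕ (2 ℕ.+ n))) ⟨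
  fromℕ (suc k) * (total χ l * binomial (suc l) (fromℕ (2 ℕ.+ n))) ∎)
  where
  open ≡-Reasoning
  n = k ℕ.+ l
  z = fromℕ (suc n)
  swap : ∀ x y w → x * (y * w) ≡ y * (x * w)
  swap = solve-∀ ℚ-ring

-- The identity d(I; z) + d(J; z) = d(J; m) · binomial(z, m) at z = n + 2, with m = l + 1, `χ`
-- describing I and `χ′` describing J.
total-merge : ∀ {χ χ′ l n} → l ℕ.≤ n → χ l ≡ true → χ′ l ≡ false →
        (∀ {t} → t ℕ.< l → χ t ≡ χ′ t) →
        (∀ {t} → l ℕ.< t → χ t ≡ false) → (∀ {t} → l ℕ.< t → χ′ t ≡ false) →
        total χ (suc n) + total χ′ (suc n) ≡ total χ′ l * binomial (suc l) (fromℕ (2 ℕ.+ n))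
total-merge {χ} {χ′} {l} {n} l≤n on off e past past′ = begin
  total χ (suc n) + total χ′ (suc n)
    ≡⟨ Σ<-+ (2 ℕ.+ n) (count χ (suc n)) (count χ′ (suc n)) ⟨
  Σ< (2 ℕ.+ n) (λ j → count χ (suc n) j + count χ′ (suc n) j)
    -- `prefixCount` reads the pattern only below `l`, where `χ` may be exchanged for `χ′`.
    ≡⟨ Σ<-cong (2 ℕ.+ n) (λ {j} _ → trans (merge l≤n on off e past past′ j) (prefixCount-cong l (suc n) e j)) ⟩
  Σ< (2 ℕ.+ n) (prefixCount χ′ l (suc n))
    ≡⟨ cong (λ i → Σ< (suc i) (prefixCount χ′ l i)) (ℕ.m∸n+n≡m (ℕ.m≤n⇒m≤1+n l≤n)) ⟨
  Σ< (suc (k ℕ.+ l)) (prefixCount χ′ l (k ℕ.+ l))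
    ≡⟨ total-prefixCount-binomial χ′ l k ⟩
  total χ′ l * binomial (suc l) (fromℕ (suc (k ℕ.+ l)))
    ≡⟨ cong (λ i → total χ′ l * binomial (suc l) (fromℕ (suc i))) (ℕ.m∸n+n≡m (ℕ.m≤n⇒m≤1+n l≤n)) ⟩
  total χ′ l * binomial (suc l) (fromℕ (2 ℕ.+ n)) ∎
  where
  open ≡-Reasoning
  k = suc n ℕ.∸ l

-- Polynomial functions

IsPolynomial : (ℚ → ℚ) → Set
IsPolynomial f = ∃ λ p → ∀ z → evaluate p z ≡ f z

const-isPolynomial : ∀ a → IsPolynomial (λ _ → a)
const-isPolynomial a = a ∷ [] , λ z → trans (cong (a +_) (*-zeroʳ z)) (+-identityʳ a)

z*-isPolynomial : ∀ {f} → IsPolynomial f → IsPolynomial (λ z → z * f z)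
z*-isPolynomial (p , e) = 0ℚ ∷ p , λ z → trans (+-identityˡ (z * evaluate p z)) (cong (z *_) (e z))

+-isPolynomial : ∀ {f g} → IsPolynomial f → IsPolynomial g → IsPolynomial (λ z → f z + g z)
+-isPolynomial (p , e) (q , e′) = p ⊕ q , λ z → trans (evaluate-⊕ p q z) (cong₂ _+_ (e z) (e′ z))
  where
  _⊕_ : Polynomial → Polynomial → Polynomial
  []      ⊕ q       = q
  (a ∷ p) ⊕ []      = a ∷ p
  (a ∷ p) ⊕ (b ∷ q) = a + b ∷ p ⊕ q
  lemma : ∀ a b z x y → a + b + z * (x + y) ≡ (a + z * x) + (b + z * y)
  lemma = solve-∀ ℚ-ring
  evaluate-⊕ : ∀ p q z → evaluate (p ⊕ q) z ≡ evaluate p z + evaluate q z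
  evaluate-⊕ []      q       z = sym (+-identityˡ (evaluate q z))
  evaluate-⊕ (a ∷ p) []      z = sym (+-identityʳ (evaluate (a ∷ p) z))
  evaluate-⊕ (a ∷ p) (b ∷ q) z =
    trans (cong (λ x → a + b + z * x) (evaluate-⊕ p q z)) (lemma a b z (evaluate p z) (evaluate q z))

*-isPolynomial : ∀ a {f} → IsPolynomial f → IsPolynomial (λ z → a * f z)
*-isPolynomial a (p , e) = map (a *_) p , λ z → trans (evaluate-* p z) (cong (a *_) (e z))
  where
  lemma : ∀ a b z x → a * b + z * (a * x) ≡ a * (b + z * x)
  lemma = solve-∀ ℚ-ring
  evaluate-* : ∀ p z → evaluate (map (a *_) p) z ≡ a * evaluate p z
  evaluate-* []      z = sym (*-zeroʳ a)
  evaluate-* (b ∷ p) z = trans (cong (λ x → a * b + z * x) (evaluate-* p z)) (lemma a b z (evaluate p z))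

≗-isPolynomial : ∀ {f g} → f ≗ g → IsPolynomial f → IsPolynomial g
≗-isPolynomial f≗g (p , e) = p , λ z → trans (e z) (f≗g z)

minus-isPolynomial : ∀ {f g} → IsPolynomial f → IsPolynomial g → IsPolynomial (λ z → f z - g z)
minus-isPolynomial {f} {g} P Q =
  ≗-isPolynomial (λ z → lemma (f z) (g z)) (+-isPolynomial P (*-isPolynomial (- 1ℚ) Q))
  where
  lemma : ∀ x y → x + - 1ℚ * y ≡ x - y
  lemma = solve-∀ ℚ-ring

binomial-isPolynomial : ∀ l → IsPolynomial (binomial l)
binomial-isPolynomial zero    = const-isPolynomial 1ℚ
binomial-isPolynomial (suc l) = *-isPolynomial (1/suc l)
  (≗-isPolynomial (λ z → lemma z (fromℕ l) (binomial l z))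
    (minus-isPolynomial (z*-isPolynomial B) (*-isPolynomial (fromℕ l) B)))
  where
  B = binomial-isPolynomial l
  lemma : ∀ z l b → z * b - l * b ≡ (z - l) * b
  lemma = solve-∀ ℚ-ring

-- Division by a linear factor and uniqueness

quotient : ℚ → Polynomial → Polynomial
quotient a []      = []
quotient a (c ∷ p) = evaluate (c ∷ p) a ∷ quotient a p

length-quotient : ∀ a p → length (quotient a p) ≡ length p
length-quotient a []      = refl
length-quotient a (c ∷ p) = cong suc (length-quotient a p)

-- Horner's scheme: the values at `a` of the successive tails are the coefficients of the quotient
-- of `c ∷ p` by z - a, which has one coefficient less.
factor-theorem : ∀ a c p z → evaluate (c ∷ p) z ≡ evaluate (c ∷ p) a + (z - a) * evaluate (quotient a p) z
factor-theorem a c [] z = lemma a c z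
  where
  lemma : ∀ a c z → c + z * 0ℚ ≡ (c + a * 0ℚ) + (z - a) * 0ℚ
  lemma = solve-∀ ℚ-ring
factor-theorem a c (b ∷ p) z =
  trans (cong (λ x → c + z * x) (factor-theorem a b p z))
        (lemma a c z (evaluate (b ∷ p) a) (evaluate (quotient a p) z))
  where
  lemma : ∀ a c z x y → c + z * (x + (z - a) * y) ≡ (c + a * x) + (z - a) * (x + z * y)
  lemma = solve-∀ ℚ-ring

-- Divide by z - m: the quotient is shorter and still vanishes at every natural number above m,
-- since n - m is nonzero there.
vanishing : ∀ p m → (∀ {n} → m ℕ.≤ n → evaluate p (fromℕ n) ≡ 0ℚ) → ∀ z → evaluate p z ≡ 0ℚ
vanishing p m roots z = bounded (length p) p refl m roots z
  where
  bounded : ∀ k p → length p ≡ k → ∀ m → (∀ {n} → m ℕ.≤ n → evaluate p (fromℕ n) ≡ 0ℚ) → ∀ z → evaluate p z ≡ 0ℚ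
  bounded zero    []      _  m roots z = refl
  bounded (suc k) (c ∷ p) eq m roots z = begin
    evaluate (c ∷ p) z                                ≡⟨ factor-theorem (fromℕ m) c p z ⟩
    evaluate (c ∷ p) (fromℕ m) + (z - fromℕ m) * q z  ≡⟨ cong₂ (λ x y → x + (z - fromℕ m) * y) (roots ℕ.≤-refl) q≡0 ⟩
    0ℚ + (z - fromℕ m) * 0ℚ                           ≡⟨ lemma (z - fromℕ m) ⟩
    0ℚ                                                ∎
    where
    open ≡-Reasoning
    lemma : ∀ x → 0ℚ + x * 0ℚ ≡ 0ℚ
    lemma = solve-∀ ℚ-ring
    q : ℚ → ℚ
    q = evaluate (quotient (fromℕ m) p)
    q-roots : ∀ {n} → suc m ℕ.≤ n → q (fromℕ n) ≡ 0ℚ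
    q-roots {n = suc n} (s≤s m≤n) = *-cancelˡ (fromℕ (suc (n ℕ.∸ m))) {{fromℕ-nonZero (n ℕ.∸ m)}} (begin
      fromℕ (suc (n ℕ.∸ m)) * q ν                   ≡⟨ cong (λ i → fromℕ i * q ν) (ℕ.+-∸-assoc 1 m≤n) ⟨
      fromℕ (suc n ℕ.∸ m) * q ν                     ≡⟨ cong (_* q ν) (fromℕ-∸ (ℕ.m≤n⇒m≤1+n m≤n)) ⟩
      (ν - fromℕ m) * q ν                           ≡⟨ +-identityˡ ((ν - fromℕ m) * q ν) ⟨
      0ℚ + (ν - fromℕ m) * q ν                      ≡⟨ cong (_+ (ν - fromℕ m) * q ν) (roots ℕ.≤-refl) ⟨
      evaluate (c ∷ p) (fromℕ m) + (ν - fromℕ m) * q ν ≡⟨ factor-theorem (fromℕ m) c p ν ⟨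
      evaluate (c ∷ p) ν                            ≡⟨ roots (ℕ.m≤n⇒m≤1+n m≤n) ⟩
      0ℚ                                            ≡⟨ *-zeroʳ (fromℕ (suc (n ℕ.∸ m))) ⟨
      fromℕ (suc (n ℕ.∸ m)) * 0ℚ                    ∎)
      where ν = fromℕ (suc n)
    q≡0 : q z ≡ 0ℚ
    q≡0 = bounded k (quotient (fromℕ m) p) (trans (length-quotient (fromℕ m) p) (ℕ.suc-injective eq)) (suc m) q-roots z

-- Transfers agreement at large integers to all arguments, in particular to elements of I, where the
-- condition defining the descent polynomial says nothing.
polynomial-unique : ∀ {f g} → IsPolynomial f → IsPolynomial g →
                    ∀ m → (∀ {n} → m ℕ.≤ n → f (fromℕ n) ≡ g (fromℕ n)) → f ≗ g
polynomial-unique {f} {g} P Q m agree z = difference (minus-isPolynomial P Q)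
  where
  open ≡-Reasoning
  lemma : ∀ x y → x ≡ (x - y) + y
  lemma = solve-∀ ℚ-ring
  difference : IsPolynomial (λ z → f z - g z) → f z ≡ g z
  difference (r , e) = begin
    f z                 ≡⟨ lemma (f z) (g z) ⟩
    (f z - g z) + g z   ≡⟨ cong (_+ g z) (e z) ⟨
    evaluate r z + g z  ≡⟨ cong (_+ g z) (vanishing r m (λ {n} m≤n → trans (e (fromℕ n)) (cancel (agree m≤n))) z) ⟩
    0ℚ + g z            ≡⟨ +-identityˡ (g z) ⟩
    g z                 ∎
    where
    cancel : ∀ {x y} → x ≡ y → x - y ≡ 0ℚ
    cancel {x} refl = +-inverseʳ x

-- Induction on the largest descent

remove-at : ℕ → (ℕ → Bool) → ℕ → Bool
remove-at m χ t = not (does (t ℕ.≟ m)) ∧ χ t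

remove-at-≡ : ∀ m χ → remove-at m χ m ≡ false
remove-at-≡ m χ rewrite dec-true (m ℕ.≟ m) refl = refl

remove-at-≢ : ∀ {m t} χ → t ≢ m → remove-at m χ t ≡ χ t
remove-at-≢ {m} {t} χ t≢m rewrite dec-false (t ℕ.≟ m) t≢m = refl

-- Index t stands for position t + 1, whence the shifts. The values are carried along with the zeros
-- because the zero at the largest element comes from a value for the smaller set.
Interpolates : (ℕ → Bool) → ℕ → (ℚ → ℚ) → Set
Interpolates χ m f = (∀ {n} → m ℕ.≤ n → f (fromℕ (suc n)) ≡ total χ n)
                   × (∀ {t} → χ t ≡ true → f (fromℕ (suc t)) ≡ 0ℚ)

-- The set I lies in {1, ..., m}. Raising this bound by one either adds nothing or adds m + 1 as the
-- largest element.
interpolation : ∀ m χ → (∀ {t} → m ℕ.≤ t → χ t ≡ false) → ∃ λ f → IsPolynomial f × Interpolates χ m f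
interpolation zero    χ supp =
  (λ _ → 1ℚ) , const-isPolynomial 1ℚ ,
  (λ {n} _ → sym (ascending (λ _ → supp z≤n) n)) ,
  λ on → contradiction (trans (sym on) (supp z≤n)) λ ()
interpolation (suc m) χ supp with χ m in eq
... | false with f , P , values , zeros ← interpolation m χ
                   (λ m≤t → [ supp , (λ { refl → eq }) ]′ (ℕ.m≤n⇒m<n∨m≡n m≤t))
  = f , P , (values ∘ ℕ.<⇒≤) , zeros
... | true with g , P , values , zeros ← interpolation m (remove-at m χ)
                   (λ m≤t → [ (λ m<t → trans (remove-at-≢ χ (ℕ.>⇒≢ m<t)) (supp m<t)) , (λ { refl → remove-at-≡ m χ }) ]′
                              (ℕ.m≤n⇒m<n∨m≡n m≤t))
  -- The identity solved for d(I; z), where `g` interpolates J, the set without m + 1.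
  = (λ z → total χ′ m * binomial (suc m) z - g z) ,
    minus-isPolynomial (*-isPolynomial (total χ′ m) (binomial-isPolynomial (suc m))) P ,
    values′ , zeros′
  where
  open ≡-Reasoning
  χ′ = remove-at m χ
  values′ : ∀ {n} → suc m ℕ.≤ n → total χ′ m * binomial (suc m) (fromℕ (suc n)) - g (fromℕ (suc n)) ≡ total χ n
  values′ {suc n} (s≤s m≤n) = begin
    total χ′ m * binomial (suc m) (fromℕ (2 ℕ.+ n)) - g (fromℕ (2 ℕ.+ n))
      ≡⟨ cong₂ _-_ (sym (total-merge m≤n eq (remove-at-≡ m χ) (λ t<m → sym (remove-at-≢ χ (ℕ.<⇒≢ t<m))) supp
                     (λ m<t → trans (remove-at-≢ χ (ℕ.>⇒≢ m<t)) (supp m<t))))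
                   (values (ℕ.m≤n⇒m≤1+n m≤n)) ⟩
    (total χ (suc n) + total χ′ (suc n)) - total χ′ (suc n)
      ≡⟨ lemma (total χ (suc n)) (total χ′ (suc n)) ⟩
    total χ (suc n) ∎
    where
    lemma : ∀ x y → (x + y) - y ≡ x
    lemma = solve-∀ ℚ-ring
  zeros′ : ∀ {t} → χ t ≡ true → total χ′ m * binomial (suc m) (fromℕ (suc t)) - g (fromℕ (suc t)) ≡ 0ℚ
  zeros′ {t} on with ℕ.<-cmp t m
  ... | tri< t<m _ _ = begin
    total χ′ m * binomial (suc m) (fromℕ (suc t)) - g (fromℕ (suc t))
      ≡⟨ cong₂ (λ x y → total χ′ m * x - y) (binomial-zero (s≤s t<m)) (zeros (trans (remove-at-≢ χ (ℕ.<⇒≢ t<m)) on)) ⟩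
    total χ′ m * 0ℚ - 0ℚ  ≡⟨ lemma (total χ′ m) ⟩
    0ℚ                    ∎
    where
    lemma : ∀ x → x * 0ℚ - 0ℚ ≡ 0ℚ
    lemma = solve-∀ ℚ-ring
  -- At z = m + 1 the binomial is 1, and `g` already takes the value d(J; m + 1) because J lies in
  -- {1, ..., m}; the two terms cancel.
  ... | tri≈ _ refl _ = begin
    total χ′ m * binomial (suc m) (fromℕ (suc m)) - g (fromℕ (suc m))
      ≡⟨ cong₂ (λ x y → total χ′ m * x - y) (binomial-diagonal (suc m)) (values ℕ.≤-refl) ⟩
    total χ′ m * 1ℚ - total χ′ m  ≡⟨ lemma (total χ′ m) ⟩
    0ℚ                            ∎
    where
    lemma : ∀ x → x * 1ℚ - x ≡ 0ℚ
    lemma = solve-∀ ℚ-ring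
  ... | tri> _ _ m<t = contradiction (trans (sym on) (supp m<t)) λ ()

-- Permutations

does-true : ∀ {A : Set} (A? : Dec A) → does A? ≡ true → A
does-true (yes a) _ = a

length-filter-map : ∀ {A B : Set} {P : Pred B 0ℓ} (P? : Decidable P) (f : A → B) xs →
                    length (filter P? (map f xs)) ≡ length (filter (P? ∘ f) xs)
length-filter-map P? f []       = refl
length-filter-map P? f (x ∷ xs) with does (P? (f x))
... | true  = cong suc (length-filter-map P? f xs)
... | false = length-filter-map P? f xs

Σ<-head : ∀ n c → c 0 + Σ< n (c ∘ suc) ≡ Σ< (suc n) c
Σ<-head zero    c = +-comm (c 0) 0ℚ
Σ<-head (suc n) c = trans (sym (+-assoc (c 0) (Σ< n (c ∘ suc)) (c (suc n)))) (cong (_+ c (suc n)) (Σ<-head n c))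

-- The enumeration `f` is arbitrary so that the induction can pass to `f ∘ suc`; the case needed is
-- `f` = `id`, for the list of all first entries.
length-filter-product : ∀ {A B C : Set} {P : Pred C 0ℓ} (P? : Decidable P) (g : A → B → C) ys n (f : Fin n → A) c →
  (∀ x → fromℕ (length (filter (P? ∘ g (f x)) ys)) ≡ c (toℕ x)) →
  fromℕ (length (filter P? (cartesianProductWith g (tabulate f) ys))) ≡ Σ< n c
length-filter-product P? g ys zero    f c e = refl
length-filter-product P? g ys (suc n) f c e = begin
  fromℕ (length (filter P? (map (g (f zero)) ys ++ rest)))
    ≡⟨ cong (fromℕ ∘ length) (filter-++ P? (map (g (f zero)) ys) rest) ⟩
  fromℕ (length (filter P? (map (g (f zero)) ys) ++ filter P? rest))
    ≡⟨ cong fromℕ (length-++ (filter P? (map (g (f zero)) ys))) ⟩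
  fromℕ (length (filter P? (map (g (f zero)) ys)) ℕ.+ length (filter P? rest))
    ≡⟨ fromℕ-+ (length (filter P? (map (g (f zero)) ys))) (length (filter P? rest)) ⟩
  fromℕ (length (filter P? (map (g (f zero)) ys))) + fromℕ (length (filter P? rest))
    ≡⟨ cong₂ _+_ (trans (cong fromℕ (length-filter-map P? (g (f zero)) ys)) (e zero))
                 (length-filter-product P? g ys n (f ∘ suc) (c ∘ suc) (e ∘ suc)) ⟩
  c 0 + Σ< n (c ∘ suc)
    ≡⟨ Σ<-head n c ⟩
  Σ< (suc n) c ∎
  where
  open ≡-Reasoning
  rest = cartesianProductWith g (tabulate (f ∘ suc)) ys

HasDescents : (ℕ → Bool) → ∀ {n} → Permutation′ (suc n) → Set
HasDescents χ π = ∀ k → does ((π ⟨$⟩ʳ suc k) <? (π ⟨$⟩ʳ inject₁ k)) ≡ χ (toℕ k)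

hasDescents? : ∀ χ {n} (π : Permutation′ (suc n)) → Dec (HasDescents χ π)
hasDescents? χ π = all? λ k → _ Bool.≟ _

-- `punchIn` moves only values from `j` upward, and moves them up, so none crosses `j`.
punchIn-<ᵇ : ∀ {n} (j : Fin (suc n)) k → (toℕ (punchIn j k) <ᵇ toℕ j) ≡ (toℕ k <ᵇ toℕ j)
punchIn-<ᵇ zero    k       = refl
punchIn-<ᵇ (suc j) zero    = refl
punchIn-<ᵇ (suc j) (suc k) = punchIn-<ᵇ j k

punchIn-mono-<ᵇ : ∀ {n} (j : Fin (suc n)) k l → (toℕ (punchIn j k) <ᵇ toℕ (punchIn j l)) ≡ (toℕ k <ᵇ toℕ l)
punchIn-mono-<ᵇ zero    k       l       = refl
punchIn-mono-<ᵇ (suc j) zero    zero    = refl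
punchIn-mono-<ᵇ (suc j) zero    (suc l) = refl
punchIn-mono-<ᵇ (suc j) (suc k) zero    = refl
punchIn-mono-<ᵇ (suc j) (suc k) (suc l) = punchIn-mono-<ᵇ j k l

-- `insert zero j ρ` is `j` followed by the entries of `ρ` punched in around `j`, which preserves
-- their mutual order and decides the first position by comparing the first entry of `ρ` with `j`.
hasDescents-insert : ∀ χ {n} (j : Fin (2 ℕ.+ n)) (ρ : Permutation′ (suc n)) →
  HasDescents χ (insert zero j ρ) ⇔
  ((toℕ (ρ ⟨$⟩ʳ zero) <ᵇ toℕ j) ≡ χ 0 × HasDescents (χ ∘ suc) ρ)
hasDescents-insert χ {n} j ρ = mk⇔
  (λ h → trans (sym at-zero) (h zero) , λ k → trans (sym (at-suc k)) (h (suc k)))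
  λ { (h , hs) zero → trans at-zero h ; (h , hs) (suc k) → trans (at-suc k) (hs k) }
  where
  π : Permutation′ (2 ℕ.+ n)
  π = insert zero j ρ
  at-zero : (toℕ (π ⟨$⟩ʳ suc zero) <ᵇ toℕ j) ≡ (toℕ (ρ ⟨$⟩ʳ zero) <ᵇ toℕ j)
  at-zero = trans (cong (λ x → toℕ x <ᵇ toℕ j) (insert-punchIn zero j ρ zero)) (punchIn-<ᵇ j (ρ ⟨$⟩ʳ zero))
  at-suc : ∀ k → (toℕ (π ⟨$⟩ʳ suc (suc k)) <ᵇ toℕ (π ⟨$⟩ʳ suc (inject₁ k))) ≡
                 (toℕ (ρ ⟨$⟩ʳ suc k) <ᵇ toℕ (ρ ⟨$⟩ʳ inject₁ k))
  at-suc k = trans (cong₂ (λ x y → toℕ x <ᵇ toℕ y) (insert-punchIn zero j ρ (suc k)) (insert-punchIn zero j ρ (inject₁ k)))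
                   (punchIn-mono-<ᵇ j (ρ ⟨$⟩ʳ suc k) (ρ ⟨$⟩ʳ inject₁ k))

≤⇒≮ᵇ : ∀ {m n} → n ℕ.≤ m → (m <ᵇ n) ≡ false
≤⇒≮ᵇ {m} {n} n≤m = dec-false (m ℕ.<? n) (ℕ.≤⇒≯ n≤m)

Σ<-below : ∀ {i j} c → j ℕ.≤ i → Σ< i (λ k → if k <ᵇ j then c k else 0ℚ) ≡ Σ< j c
Σ<-below {zero} c z≤n = refl
Σ<-below {suc i} {j} c j≤1+i with ℕ.m≤n⇒m<n∨m≡n j≤1+i
... | inj₁ (s≤s j≤i) rewrite ≤⇒≮ᵇ j≤i = trans (+-identityʳ _) (Σ<-below c j≤i)
... | inj₂ refl = Σ<-cong (suc i) λ {k} k<j → cong (λ b → if b then c k else 0ℚ) (dec-true (k ℕ.<? suc i) k<j)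

-- Identifies `step` as the sum over the second entries `k` that `β` allows, numbered among the
-- entries other than `j`. Ascents are the complement of descents.
Σ<-select : ∀ β {n j} c → j ℕ.≤ suc n →
            Σ< (suc n) (λ k → if does ((k <ᵇ j) Bool.≟ β) then c k else 0ℚ) ≡ step β n c j
Σ<-select true {n} {j} c j≤1+n = trans (Σ<-cong (suc n) λ {k} _ → simplify (k <ᵇ j) (c k)) (Σ<-below c j≤1+n)
  where
  simplify : ∀ b x → (if does (b Bool.≟ true) then x else 0ℚ) ≡ (if b then x else 0ℚ)
  simplify true  x = refl
  simplify false x = refl
Σ<-select false {n} {j} c j≤1+n = begin
  Σ< (suc n) above
    ≡⟨ lemma (Σ< (suc n) above) (Σ< (suc n) below) ⟩
  (Σ< (suc n) above + Σ< (suc n) below) - Σ< (suc n) below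
    ≡⟨ cong (_- Σ< (suc n) below) (Σ<-+ (suc n) above below) ⟨
  Σ< (suc n) (λ k → above k + below k) - Σ< (suc n) below
    ≡⟨ cong₂ _-_ (Σ<-cong (suc n) λ {k} _ → split (k <ᵇ j) (c k)) (Σ<-below c j≤1+n) ⟩
  Σ< (suc n) c - Σ< j c ∎
  where
  open ≡-Reasoning
  above below : ℕ → ℚ
  above k = if does ((k <ᵇ j) Bool.≟ false) then c k else 0ℚ
  below k = if k <ᵇ j then c k else 0ℚ
  split : ∀ b x → (if does (b Bool.≟ false) then x else 0ℚ) + (if b then x else 0ℚ) ≡ x
  split true  x = +-identityˡ x
  split false x = +-identityʳ x
  lemma : ∀ x y → x ≡ (x + y) - y
  lemma = solve-∀ ℚ-ring

length-filter-× : ∀ {A B : Set} {P Q : Pred A 0ℓ} (P? : Decidable P) (B? : Dec B) (Q? : Decidable Q) →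
                  (∀ x → P x ⇔ (B × Q x)) → ∀ xs →
                  fromℕ (length (filter P? xs)) ≡ (if does B? then fromℕ (length (filter Q? xs)) else 0ℚ)
length-filter-× P? (yes b) Q? P⇔B×Q xs = cong (fromℕ ∘ length)
  (filter-≐ P? Q? ((λ {x} → proj₂ ∘ Equivalence.to (P⇔B×Q x)) , λ {x} q → Equivalence.from (P⇔B×Q x) (b , q)) xs)
length-filter-× P? (no ¬b) Q? P⇔B×Q xs = cong (fromℕ ∘ length)
  (filter-none P? (All.universal (λ x → ¬b ∘ proj₁ ∘ Equivalence.to (P⇔B×Q x)) xs))

-- Split by the second entry `k`: comparing it with `j` settles the first position, and the
-- remaining pattern is counted recursively.
count-first : ∀ χ n (j : Fin (suc n)) →
  fromℕ (length (filter (λ ρ → hasDescents? χ (insert zero j ρ)) (permutations n))) ≡ count χ n (toℕ j)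
count-first χ zero    zero = refl
count-first χ (suc n) j = trans
  (length-filter-product (λ ρ → hasDescents? χ (insert zero j ρ)) (insert zero) (permutations n) (suc n) id
    (λ k → if does ((k <ᵇ toℕ j) Bool.≟ χ 0) then count (χ ∘ suc) n k else 0ℚ) second)
  (Σ<-select (χ 0) (count (χ ∘ suc) n) (ℕ.≤-pred (toℕ<n j)))
  where
  second : ∀ k → fromℕ (length (filter (λ σ → hasDescents? χ (insert zero j (insert zero k σ))) (permutations n))) ≡
           (if does ((toℕ k <ᵇ toℕ j) Bool.≟ χ 0) then count (χ ∘ suc) n (toℕ k) else 0ℚ)
  second k = trans
    (length-filter-× (λ σ → hasDescents? χ (insert zero j (insert zero k σ))) ((toℕ k <ᵇ toℕ j) Bool.≟ χ 0)
      (λ σ → hasDescents? (χ ∘ suc) (insert zero k σ)) (λ σ → hasDescents-insert χ j (insert zero k σ)) (permutations n))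
    (cong (λ x → if does ((toℕ k <ᵇ toℕ j) Bool.≟ χ 0) then x else 0ℚ) (count-first (χ ∘ suc) n k))

-- Descent sets as Boolean patterns

indicator : List ℕ → ℕ → Bool
indicator I t = does (_∈?_ ℕ._≟_ (suc t) I)

isDescent⇔ : ∀ {n} (π : Permutation′ (suc n)) k →
             IsDescent π (suc (toℕ k)) ⇔ toℕ (π ⟨$⟩ʳ suc k) ℕ.< toℕ (π ⟨$⟩ʳ inject₁ k)
isDescent⇔ π k = mk⇔ to (λ lt → inject₁ k , suc k , cong suc (toℕ-inject₁ k) , refl , lt)
  where
  to : IsDescent π (suc (toℕ k)) → toℕ (π ⟨$⟩ʳ suc k) ℕ.< toℕ (π ⟨$⟩ʳ inject₁ k)
  to (a , b , a≡ , b≡ , lt) = subst₂ (λ x y → toℕ (π ⟨$⟩ʳ x) ℕ.< toℕ (π ⟨$⟩ʳ y))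
    (toℕ-injective b≡) (toℕ-injective (trans (ℕ.suc-injective a≡) (sym (toℕ-inject₁ k)))) lt

descentPosition : ∀ {n} (π : Permutation′ (suc n)) {t} → IsDescent π t → ∃ λ (k : Fin n) → suc (toℕ k) ≡ t
descentPosition π (a , suc k , _ , b≡ , _) = k , b≡
descentPosition π (a , zero , a≡ , b≡ , _) = contradiction (trans a≡ (sym b≡)) λ ()

-- `HasDescents` inspects exactly the positions 1 to n; positivity and the bound place all of I
-- among them.
hasDescentSet⇔ : ∀ {I n} → (∀ {t} → t ∈ I → 0 ℕ.< t) → (∀ {t} → t ∈ I → t ℕ.< suc n) →
                 (π : Permutation′ (suc n)) → HasDescentSet I π ⇔ HasDescents (indicator I) π
hasDescentSet⇔ {I} {n} positive bounded π = mk⇔ to (λ h → descents⊆I h , I⊆descents h)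
  where
  to : HasDescentSet I π → HasDescents (indicator I) π
  to (D⊆I , I⊆D) k = does-⇔ (mk⇔
      (λ lt → D⊆I (∈-filter⁺ (isDescent? π) (∈-upTo⁺ (s≤s (toℕ<n k))) (Equivalence.from (isDescent⇔ π k) lt)))
      (λ k∈I → Equivalence.to (isDescent⇔ π k) (proj₂ (∈-filter⁻ (isDescent? π) {xs = upTo (suc n)} (I⊆D k∈I)))))
    ((π ⟨$⟩ʳ suc k) <? (π ⟨$⟩ʳ inject₁ k)) (_∈?_ ℕ._≟_ (suc (toℕ k)) I)
  descents⊆I : HasDescents (indicator I) π → ∀ {t} → t ∈ descents π → t ∈ I
  descents⊆I h t∈D with desc ← proj₂ (∈-filter⁻ (isDescent? π) {xs = upTo (suc n)} t∈D) with descentPosition π desc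
  ... | k , refl = does-true (_∈?_ ℕ._≟_ (suc (toℕ k)) I)
    (trans (sym (h k)) (dec-true ((π ⟨$⟩ʳ suc k) <? (π ⟨$⟩ʳ inject₁ k)) (Equivalence.to (isDescent⇔ π k) desc)))
  I⊆descents : HasDescents (indicator I) π → ∀ {t} → t ∈ I → t ∈ descents π
  I⊆descents h {zero} 0∈I = contradiction (positive 0∈I) λ ()
  I⊆descents h {suc t} t∈I = ∈-filter⁺ (isDescent? π) (∈-upTo⁺ (bounded t∈I))
    (subst (IsDescent π ∘ suc) k≡t (Equivalence.from (isDescent⇔ π k)
      (does-true ((π ⟨$⟩ʳ suc k) <? (π ⟨$⟩ʳ inject₁ k))
        (trans (h k) (dec-true (_∈?_ ℕ._≟_ (suc (toℕ k)) I) (subst (λ x → suc x ∈ I) (sym k≡t) t∈I))))))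
    where
    k = fromℕ< (ℕ.≤-pred (bounded t∈I))
    k≡t = toℕ-fromℕ< (ℕ.≤-pred (bounded t∈I))

d≡total : ∀ {I n} → (∀ {t} → t ∈ I → 0 ℕ.< t) → (∀ {t} → t ∈ I → t ℕ.< suc n) →
          fromℕ (d I (suc n)) ≡ total (indicator I) n
d≡total {I} {n} positive bounded = trans
  (cong (fromℕ ∘ length) (filter-≐ (hasDescentSet? I) (hasDescents? (indicator I))
    ((λ {π} → Equivalence.to (hasDescentSet⇔ positive bounded π)) ,
     (λ {π} → Equivalence.from (hasDescentSet⇔ positive bounded π)))
    (permutations (suc n))))
  (length-filter-product (hasDescents? (indicator I)) (insert zero) (permutations n) (suc n) id
    (count (indicator I) n) (count-first (indicator I) n))

theorem4p1 : (I : List ℕ) → All (λ j → 0 < j) I →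
    (p : Polynomial) → IsDescentPolynomial I p →
    (i : ℕ) → i ∈ I → evaluate p (fromℕ i) ≡ 0ℚ
theorem4p1 I I>0 p descent zero    0∈I = contradiction (All.lookup I>0 0∈I) λ ()
theorem4p1 I I>0 p descent (suc i) i∈I = compare (interpolation (max 0 I) (indicator I) beyond-max)
  where
  ≤max : ∀ {t} → t ∈ I → t ≤ max 0 I
  ≤max = All.lookup (xs≤max 0 I)
  -- Index t is position t + 1, so the support ends just before `max 0 I`.
  beyond-max : ∀ {t} → max 0 I ≤ t → indicator I t ≡ false
  beyond-max {t} max≤t = dec-false (_∈?_ ℕ._≟_ (suc t) I) λ t∈I → ℕ.<⇒≱ (s≤s max≤t) (≤max t∈I)
  compare : (∃ λ f → IsPolynomial f × Interpolates (indicator I) (max 0 I) f) → evaluate p (fromℕ (suc i)) ≡ 0ℚ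
  compare (f , f-polynomial , values , zeros) = trans
    -- Both functions give d(I; n) for every n > max I, so they agree at i + 1 too, where `f`
    -- vanishes.
    (polynomial-unique {f = evaluate p} {g = f} (p , λ _ → refl) f-polynomial (suc (max 0 I)) agree (fromℕ (suc i)))
    (zeros (dec-true (_∈?_ ℕ._≟_ (suc i) I) i∈I))
    where
    agree : ∀ {n} → max 0 I < n → evaluate p (fromℕ n) ≡ f (fromℕ n)
    agree {suc n} max<n = trans (descent (suc n) max<n) (trans
      (d≡total {I} {n} (All.lookup I>0) λ t∈I → ℕ.≤-<-trans (≤max t∈I) max<n)
      (sym (values (ℕ.≤-pred max<n))))
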